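{- Let $a$ and $b$ be positive integers with $\gcd(a,b)=1$ and $a$ odd. Then the algorithm WWL1, run on input $(a,b)$, terminates and returns the unique pair of integers $(u,v)$ such that $ua+vb=1$ and $v\in\{0,1,\dots,a-1\}$.
   Context: For integers $x$ and $y>0$, $x \bmod y$ is the remainder in $\{0,\dots,y-1\}$ of the Euclidean division of $x$ by $y$. Subroutine Div1$(a,c,v)$: while $c \bmod 2=0$, replace $c$ by $c/2$ and replace $v$ by $v/2$ if $v$ is even, or by $(v+a)/2$ otherwise. After the loop, return $(c,v)$. Algorithm WWL1$(a,b)$: 1. Initialization. Let $b=aq+r$ with $0\le r<a$ be the Euclidean division of $b$ by $a$. Set $c_1\leftarrow b \bmod a$ (that is, $r$), $c_2\leftarrow a-c_1$, $v_1\leftarrow 1$, $v_2\leftarrow a-1$. Then set $(c_1,v_1)\leftarrow \mathrm{Div1}(a,c_1,v_1)$ and $(c_2,v_2)\leftarrow \mathrm{Div1}(a,c_2,v_2)$. If $c_2<c_1$, exchange $(c_1,v_1)$ and $(c_2,v_2)$. 2. Iteration. While $c_1>1$, do the following: set $c_2\leftarrow c_2-c_1$; if $v_2-v_1<0$ set $v_2\leftarrow v_2-v_1+a$, otherwise set $v_2\leftarrow v_2-v_1$; then set $(c_2,v_2)\leftarrow\mathrm{Div1}(a,c_2,v_2)$; then, if $c_2<c_1$, exchange $(c_1,v_1)$ and $(c_2,v_2)$. 3. Output. Set $v\leftarrow v_1$ and $u\leftarrow -vq+\frac{1-vr}{a}$, and return $(u,v)$.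
   Formalization: The case a = 1 is excluded: there the algorithm starts with c_1 = b mod 1 = 0, and Div1(1,0,1) never terminates, so the claim of termination fails for every b. -}

module Defs where

open import Data.Integer using (ℤ; +_; 0ℤ; 1ℤ; _+_; _*_; _-_; -_; _≤_; _<_; _<?_; _/ℕ_; _%ℕ_)
import Data.Nat as ℕ
open import Data.Nat.DivMod using (n%1≡0)
open import Data.Nat using (ℕ; NonZero)
open import Data.Bool using (if_then_else_)
open import Data.Empty using (⊥-elim)
open import Data.Product using (_×_; _,_)
open import Relation.Binary.PropositionalEquality using (_≡_; refl)
open import Relation.Nullary using (¬_; does)

-- Big-step semantics of `while C do Body`: a derivation of `While C Body s t`
-- is a finite run of the loop from s, so existence of one is termination
-- (see `While-deterministic`).
data While {S : Set} (C : S → Set) (Body : S → S → Set) : S → S → Set where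
  stop : ∀ {s} → ¬ C s → While C Body s s
  next : ∀ {s t u} → C s → Body s t → While C Body t u → While C Body s u

-- A pair (c , v).
Pair : Set
Pair = ℤ × ℤ

-- /ℕ and %ℕ are Euclidean quotient and remainder; the halvings of c and v
-- are only reached when exact, as is (v + a)/2 for odd a.
data Halve (a : ℕ) : Pair → Pair → Set where
  halve : ∀ {c v} →
    Halve a (c , v)
            ( c /ℕ 2
            , (if does (v %ℕ 2 ℕ.≟ 0) then v /ℕ 2 else (v + + a) /ℕ 2) )

Div1 : (a : ℕ) (c v : ℤ) → Pair → Set
Div1 a c v = While (λ (c , _) → c %ℕ 2 ≡ 0) (Halve a) (c , v)

-- ((c₁ , v₁) , (c₂ , v₂)).
State : Set
State = Pair × Pair

exchange : State → State
exchange ((c₁ , v₁) , (c₂ , v₂)) =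
  if does (c₂ <? c₁) then ((c₂ , v₂) , (c₁ , v₁)) else ((c₁ , v₁) , (c₂ , v₂))

subtract : (a : ℕ) (v₂ v₁ : ℤ) → ℤ
subtract a v₂ v₁ = if does (v₂ - v₁ <? 0ℤ) then v₂ - v₁ + + a else v₂ - v₁

data Iteration (a : ℕ) : State → State → Set where
  iteration : ∀ {c₁ v₁ c₂ v₂ p} →
    Div1 a (c₂ - c₁) (subtract a v₂ v₁) p →
    Iteration a ((c₁ , v₁) , (c₂ , v₂)) (exchange ((c₁ , v₁) , p))

-- The quotient (1 - v r)/a is taken as a Euclidean quotient to be total; an
-- output (u , v) satisfies u a + v b = 1 exactly when that division is exact.
output : (a b : ℕ) .{{_ : NonZero a}} → State → ℤ × ℤ
output a b ((_ , v) , _) = - v * + (b ℕ./ a) + (1ℤ - v * + (b ℕ.% a)) /ℕ a , v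

-- `WWL1 a b out`: the run on input (a , b) terminates and returns out.
data WWL1 (a b : ℕ) .{{_ : NonZero a}} : ℤ × ℤ → Set where
  run : ∀ {p₁ p₂ final} →
    Div1 a (+ (b ℕ.% a)) 1ℤ p₁ →
    Div1 a (+ a - + (b ℕ.% a)) (+ a - 1ℤ) p₂ →
    While (λ ((c₁ , _) , _) → 1ℤ < c₁) (Iteration a) (exchange (p₁ , p₂)) final →
    WWL1 a b (output a b final)

IsSolution : (a b : ℕ) → ℤ × ℤ → Set
IsSolution a b (u , v) = u * + a + v * + b ≡ 1ℤ × 0ℤ ≤ v × v < + a

While-deterministic : ∀ {S : Set} {C : S → Set} {Body : S → S → Set} →
  (∀ {s t t′} → Body s t → Body s t′ → t ≡ t′) →
  ∀ {s t t′} → While C Body s t → While C Body s t′ → t ≡ t′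
While-deterministic det (stop _)     (stop _)      = refl
While-deterministic det (stop ¬c)    (next c _ _)  = ⊥-elim (¬c c)
While-deterministic det (next c _ _) (stop ¬c)     = ⊥-elim (¬c c)
While-deterministic det (next _ b w) (next _ b′ w′) with refl ← det b b′ =
  While-deterministic det w w′

Div1-deterministic : ∀ {a c v p p′} → Div1 a c v p → Div1 a c v p′ → p ≡ p′
Div1-deterministic = While-deterministic λ { halve halve → refl }

Iteration-deterministic : ∀ {a s t t′} → Iteration a s t → Iteration a s t′ → t ≡ t′
Iteration-deterministic (iteration d) (iteration d′)
  with refl ← Div1-deterministic d d′ = refl

WWL1-deterministic : ∀ {a b} .{{_ : NonZero a}} {out out′} →
  WWL1 a b out → WWL1 a b out′ → out ≡ out′
WWL1-deterministic (run d₁ d₂ w) (run d₁′ d₂′ w′)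
  with refl ← Div1-deterministic d₁ d₁′
  with refl ← Div1-deterministic d₂ d₂′
  with refl ← While-deterministic Iteration-deterministic w w′ = refl

Div1-diverges-at-0 : ∀ {a v p} → ¬ Div1 a 0ℤ v p
Div1-diverges-at-0 (stop ¬even)     = ¬even refl
Div1-diverges-at-0 (next _ halve w) = Div1-diverges-at-0 w

-- For a = 1 the initialization runs Div1 on c₁ = b mod 1 = 0, which loops
-- forever; this is why a = 1 has to be excluded from the correctness theorem.
WWL1-diverges-at-1 : ∀ b {out} → ¬ WWL1 1 b out
WWL1-diverges-at-1 b (run d _ _) rewrite n%1≡0 b = Div1-diverges-at-0 d

{-# OPTIONS --safe #-}

-- With r = b mod a, the loop keeps c₁ and c₂ odd and coprime to each other, and
-- c ≡ v r (mod a) with 0 ≤ v < a for both pairs; halving preserves the congruence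
-- because 2 is invertible modulo the odd number a.  Coprimality forces c₁ < c₂ as
-- long as 1 < c₁, so c₁ + c₂ decreases until c₁ = 1, where v₁ inverts b modulo a.
module Submission where

open import Defs
open import Algebra using (AbelianGroup)
open import Data.Bool using (true; false)
open import Data.Integer
  using (ℤ; +_; -[1+_]; 0ℤ; 1ℤ; _+_; _*_; _-_; -_; +<+; +≤+; ∣_∣; _/ℕ_; _%ℕ_)
import Data.Integer as ℤ
open import Data.Integer.DivMod using (a≡a%ℕn+[a/ℕn]*n; n%ℕd<d)
open import Data.Integer.Divisibility.Signed
  using (_∣_; divides; ∣⇒∣ᵤ; ∣m∣n⇒∣m-n; ∣n⇒∣m*n; ∣-refl)
import Data.Integer.Properties as ℤ
open import Algebra.Properties.Group (AbelianGroup.group ℤ.+-0-abelianGroup) using (∙-cancelʳ)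
open import Data.Integer.Tactic.RingSolver using (solve-∀)
open import Data.Nat using (ℕ; NonZero; _%_; _/_; _∸_; zero; suc; z≤n; s≤s; z<s; s<s)
import Data.Nat as ℕ
open import Data.Nat.Coprimality using (Coprime; gcd≡1⇒coprime)
import Data.Nat.Coprimality as Coprime
import Data.Nat.Divisibility as ℕ
import Data.Nat.DivMod as ℕ
open import Data.Nat.GCD using (gcd)
open import Data.Nat.Induction using (<-wellFounded)
import Data.Nat.Properties as ℕ
open import Data.Product using (_×_; _,_; Σ-syntax; ∃-syntax)
open import Data.Sum using (inj₁; inj₂)
open import Function using (_∘_)
open import Induction.WellFounded using (Acc; acc)
open import Relation.Binary.PropositionalEquality
  using (_≡_; _≢_; refl; sym; trans; cong; cong₂; subst; module ≡-Reasoning)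
open import Relation.Nullary using (¬_; yes; no; contradiction; ofʸ; ofⁿ)

-- Parity, divisibility, and the effect of one halving or subtraction.

%2≢0⇒%2≡1 : ∀ n → n % 2 ≢ 0 → n % 2 ≡ 1
%2≢0⇒%2≡1 n odd = ℕ.≤-antisym (ℕ.≤-pred (ℕ.m%n<n n 2)) (ℕ.n≢0⇒n>0 odd)

odd∧≯1⇒≡1 : ∀ n → n % 2 ≡ 1 → ¬ 1 ℕ.< n → n ≡ 1
odd∧≯1⇒≡1 1             _ _   = refl
odd∧≯1⇒≡1 (suc (suc _)) _ 1≮n = contradiction (s<s z<s) 1≮n

-- If `m` and `n` were equal, `m` would be a common divisor and hence 1. The strict inequality keeps
-- the difference of the two entries positive, so that `Div1` terminates on it.
coprime∧≤⇒< : ∀ {m n} → 1 ℕ.< m → m ℕ.≤ n → Coprime m n → m ℕ.< n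
coprime∧≤⇒< 1<m m≤n coprime =
  ℕ.≤∧≢⇒< m≤n λ { refl → ℕ.<⇒≢ 1<m (sym (coprime (ℕ.∣-refl , ℕ.∣-refl))) }

odd+odd : ∀ m n → m % 2 ≡ 1 → n % 2 ≡ 1 → (m ℕ.+ n) % 2 ≡ 0
odd+odd m n m-odd n-odd = trans (ℕ.%-distribˡ-+ m n 2) (cong₂ (λ x y → (x ℕ.+ y) % 2) m-odd n-odd)

%ℕ≡⇒≡+/ℕ* : ∀ n {x} d .{{_ : NonZero d}} → n %ℕ d ≡ x → n ≡ + x + n /ℕ d * + d
%ℕ≡⇒≡+/ℕ* n d refl = a≡a%ℕn+[a/ℕn]*n n d

%ℕ≡0⇒≡/ℕ* : ∀ n d .{{_ : NonZero d}} → n %ℕ d ≡ 0 → n ≡ n /ℕ d * + d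
%ℕ≡0⇒≡/ℕ* n d d∣n = trans (%ℕ≡⇒≡+/ℕ* n d d∣n) (ℤ.+-identityˡ _)

∣⇒%ℕ≡0 : ∀ {d n} .{{_ : NonZero d}} → + d ∣ n → n %ℕ d ≡ 0
∣⇒%ℕ≡0 {d} {n} d∣n with n %ℕ d in eq
... | zero  = refl
... | suc x = contradiction (ℕ.∣⇒≤ (∣⇒∣ᵤ d∣rem)) (ℕ.<⇒≱ (subst (ℕ._< d) eq (n%ℕd<d n d)))
  where
  rearrange : ∀ x y → x + y - y ≡ x
  rearrange = solve-∀
  d∣rem : + d ∣ + suc x
  d∣rem = subst (+ d ∣_)
    (trans (cong (_- n /ℕ d * + d) (%ℕ≡⇒≡+/ℕ* n d eq)) (rearrange (+ suc x) (n /ℕ d * + d)))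
    (∣m∣n⇒∣m-n d∣n (∣n⇒∣m*n (n /ℕ d) ∣-refl))

-- The difference is a multiple of `a` of absolute value less than `a`, hence zero.
∣-⇒≡ : ∀ {a m n} → m ℕ.< a → n ℕ.< a → + a ∣ + m - + n → m ≡ n
∣-⇒≡ {a} {m} {n} m<a n<a a∣m-n = ℤ.+-injective (ℤ.i-j≡0⇒i≡j (+ m) (+ n) (zero-difference a∣m-n small))
  where
  small : ∣ + m - + n ∣ ℕ.< a
  small = subst (λ i → ∣ i ∣ ℕ.< a) (sym (ℤ.m-n≡m⊖n m n))
    (ℕ.≤-<-trans (ℤ.∣m⊝n∣≤m⊔n m n) (ℕ.⊔-lub m<a n<a))
  zero-difference : ∀ {i} → + a ∣ i → ∣ i ∣ ℕ.< a → i ≡ 0ℤ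
  zero-difference {+ zero}    _   _   = refl
  zero-difference {+ suc _}   a∣i i<a = contradiction (ℕ.∣⇒≤ (∣⇒∣ᵤ a∣i)) (ℕ.<⇒≱ i<a)
  zero-difference { -[1+ _ ]} a∣i i<a = contradiction (ℕ.∣⇒≤ (∣⇒∣ᵤ a∣i)) (ℕ.<⇒≱ i<a)

-- As a = 1 + 2 h, any x equals a x - h (2 x), so a ∣ 2 x gives a ∣ x; e is 1 if a
-- is added to v before halving and 0 otherwise.
halve-∣ : ∀ a h c c′ v v′ r e → a ≡ 1ℤ + h * + 2 → c ≡ c′ * + 2 → v + e * a ≡ v′ * + 2 →
          a ∣ c - v * r → a ∣ c′ - v′ * r
halve-∣ a h c c′ v v′ r e a-odd c-even v-even (divides k eq) =
  divides (c′ - v′ * r - h * (k - e * r)) (begin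
    c′ - v′ * r
      ≡⟨ expand h c′ v′ r ⟩
    (1ℤ + h * + 2) * (c′ - v′ * r) - h * (c′ * + 2 - v′ * + 2 * r)
      ≡⟨ cong₂ (λ x y → x * (c′ - v′ * r) - h * y) a-odd (cong₂ (λ x y → x - y * r) c-even v-even) ⟨
    a * (c′ - v′ * r) - h * (c - (v + e * a) * r)
      ≡⟨ regroup a (c′ - v′ * r) h c v e r ⟩
    a * (c′ - v′ * r) - h * ((c - v * r) - e * a * r)
      ≡⟨ cong (λ x → a * (c′ - v′ * r) - h * (x - e * a * r)) eq ⟩
    a * (c′ - v′ * r) - h * (k * a - e * a * r)
      ≡⟨ collect a (c′ - v′ * r) h k e r ⟩
    (c′ - v′ * r - h * (k - e * r)) * a ∎)
  where
  open ≡-Reasoning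
  expand : ∀ h c v r →
    c - v * r ≡ (1ℤ + h * + 2) * (c - v * r) - h * (c * + 2 - v * + 2 * r)
  expand = solve-∀
  regroup : ∀ a x h c v e r →
    a * x - h * (c - (v + e * a) * r) ≡ a * x - h * ((c - v * r) - e * a * r)
  regroup = solve-∀
  collect : ∀ a x h k e r → a * x - h * (k * a - e * a * r) ≡ (x - h * (k - e * r)) * a
  collect = solve-∀

-- Subtracting the two congruences leaves the correction `e * a`, which contributes the multiple
-- `e * r * a` of `a`.
subtract-∣ : ∀ {a v} c₁ c₂ v₁ v₂ r e → v ≡ v₂ - v₁ + e * a →
             a ∣ c₁ - v₁ * r → a ∣ c₂ - v₂ * r → a ∣ c₂ - c₁ - v * r
subtract-∣ {a} c₁ c₂ v₁ v₂ r e refl a∣₁ a∣₂ =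
  subst (a ∣_) (rearrange a c₁ c₂ v₁ v₂ r e)
    (∣m∣n⇒∣m-n (∣m∣n⇒∣m-n a∣₂ a∣₁) (∣n⇒∣m*n (e * r) ∣-refl))
  where
  rearrange : ∀ a c₁ c₂ v₁ v₂ r e →
    c₂ - v₂ * r - (c₁ - v₁ * r) - e * r * a ≡ c₂ - c₁ - (v₂ - v₁ + e * a) * r
  rearrange = solve-∀

+m-+n : ∀ {m n} → n ℕ.≤ m → + m - + n ≡ + (m ∸ n)
+m-+n {m} {n} n≤m = trans (ℤ.m-n≡m⊖n m n) (ℤ.⊖-≥ n≤m)

-- Here `e` records whether `subtract` adds `a`: it is 0 when `v₁ ≤ v₂` and 1 otherwise.
subtract-residue : ∀ {a v₁ v₂} → v₁ ℕ.< a → v₂ ℕ.< a →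
  ∃[ v ] v ℕ.< a × subtract a (+ v₂) (+ v₁) ≡ + v × ∃[ e ] + v ≡ + v₂ - + v₁ + e * + a
subtract-residue {a} {v₁} {v₂} v₁<a v₂<a with ℕ.≤-<-connex v₁ v₂
... | inj₁ v₁≤v₂ rewrite +m-+n v₁≤v₂ =
  v₂ ∸ v₁ , ℕ.≤-<-trans (ℕ.m∸n≤m v₂ v₁) v₂<a , refl , 0ℤ , sym (ℤ.+-identityʳ _)
... | inj₂ v₂<v₁ rewrite trans (ℤ.m-n≡m⊖n v₂ v₁) (ℤ.⊖-< v₂<v₁)
  -- Positivity leaves only the case `suc d`, in which the difference is `-[1+ d]` and the sign test
  -- in `subtract` computes to true.
  with v₁ ∸ v₂ | ℕ.m<n⇒0<n∸m v₂<v₁ | ℕ.≤-<-trans (ℕ.m∸n≤m v₁ v₂) v₁<a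
... | suc d | _ | d<a =
  a ∸ suc d , ℕ.∸-monoʳ-< z<s (ℕ.<⇒≤ d<a) , eq , 1ℤ ,
  trans (sym eq) (cong (λ x → -[1+ d ] + x) (sym (ℤ.*-identityˡ (+ a))))
  where
  eq : -[1+ d ] + + a ≡ + (a ∸ suc d)
  eq = ℤ.⊖-≥ (ℕ.<⇒≤ d<a)

-- The loop invariant and termination.

-- The parameters are naturals because on these runs every entry stays nonnegative and so has the
-- form `+ c` or `+ v`.
record Residue (a r c v : ℕ) : Set where
  constructor residue
  field
    bound     : v ℕ.< a
    congruent : + a ∣ + c - + v * + r

module _ {a r : ℕ} (a-odd : a % 2 ≡ 1) where

  halve-residue : ∀ {c v} → c % 2 ≡ 0 → Residue a r c v →
    ∃[ v′ ] Halve a (+ c , + v) (+ (c / 2) , + v′) × Residue a r (c / 2) v′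
  -- Abstracting `v % 2` together with the `halve` step makes the `if` in its type reduce to the
  -- branch taken.
  halve-residue {c} {v} c-even (residue v<a a∣) with v % 2 in eq | halve {a} {+ c} {+ v}
  ... | zero | step = v / 2 , step , residue (ℕ.≤-<-trans (ℕ.m/n≤m v 2) v<a)
    (halve-∣ (+ a) (+ a /ℕ 2) (+ c) (+ (c / 2)) (+ v) (+ (v / 2)) (+ r) 0ℤ
      (%ℕ≡⇒≡+/ℕ* (+ a) 2 a-odd) (%ℕ≡0⇒≡/ℕ* (+ c) 2 c-even)
      (trans (ℤ.+-identityʳ (+ v)) (%ℕ≡0⇒≡/ℕ* (+ v) 2 eq)) a∣)
  ... | suc _ | step = (v ℕ.+ a) / 2 , step , residue
    (ℕ.m<n*o⇒m/o<n (subst (v ℕ.+ a ℕ.<_) a+a≡a*2 (ℕ.+-monoˡ-< a v<a)))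
    (halve-∣ (+ a) (+ a /ℕ 2) (+ c) (+ (c / 2)) (+ v) (+ ((v ℕ.+ a) / 2)) (+ r) 1ℤ
      (%ℕ≡⇒≡+/ℕ* (+ a) 2 a-odd) (%ℕ≡0⇒≡/ℕ* (+ c) 2 c-even)
      (trans (cong (λ x → + v + x) (ℤ.*-identityˡ (+ a)))
        (%ℕ≡0⇒≡/ℕ* (+ (v ℕ.+ a)) 2 (odd+odd v a (%2≢0⇒%2≡1 v (ℕ.1+n≢0 ∘ trans (sym eq))) a-odd))) a∣)
    where
    a+a≡a*2 : a ℕ.+ a ≡ a ℕ.* 2
    a+a≡a*2 = trans (cong (a ℕ.+_) (sym (ℕ.+-identityʳ a))) (ℕ.*-comm 2 a)

  -- The divisibility `c′ ∣ c` carries both coprimality and the size bound through `Div1`.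
  Div1Result : ℕ → ℕ → Set
  Div1Result c v = ∃[ c′ ] ∃[ v′ ]
    Div1 a (+ c) (+ v) (+ c′ , + v′) × c′ % 2 ≡ 1 × c′ ℕ.∣ c × Residue a r c′ v′

  -- Halving a positive even number gives a smaller positive number, so the recursion is well
  -- founded and ends at an odd one.
  div1-residue : ∀ {c v} → 0 ℕ.< c → Residue a r c v → Div1Result c v
  div1-residue = go (<-wellFounded _)
    where
    go : ∀ {c v} → Acc ℕ._<_ c → 0 ℕ.< c → Residue a r c v → Div1Result c v
    go {c} {v} (acc rec) 0<c res with c % 2 ℕ.≟ 0
    ... | no c-odd = c , v , stop c-odd , %2≢0⇒%2≡1 c c-odd , ℕ.∣-refl , res
    ... | yes c-even with halve-residue c-even res
    ... | v₁ , step , res₁ with go (rec (ℕ.m/n<m c 2 {{ℕ.>-nonZero 0<c}} (s<s z<s)))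
                                   (ℕ.m≥n⇒m/n>0 (ℕ.∣⇒≤ {{ℕ.>-nonZero 0<c}} 2∣c)) res₁
      where
      2∣c : 2 ℕ.∣ c
      2∣c = ℕ.m%n≡0⇒n∣m c 2 c-even
    ... | c′ , v′ , steps , c′-odd , c′∣ , res′ =
      c′ , v′ , next c-even step steps , c′-odd ,
      ℕ.∣-trans c′∣ (ℕ.m/n∣m (ℕ.m%n≡0⇒n∣m c 2 c-even)) ,
      res′

  -- The index is the sum `c₁ + c₂`, the measure on which the main loop terminates.
  data Invariant : ℕ → State → Set where
    invariant : ∀ {c₁ v₁ c₂ v₂} → c₁ ℕ.≤ c₂ → c₁ % 2 ≡ 1 → c₂ % 2 ≡ 1 → Coprime c₁ c₂ →
      Residue a r c₁ v₁ → Residue a r c₂ v₂ →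
      Invariant (c₁ ℕ.+ c₂) ((+ c₁ , + v₁) , (+ c₂ , + v₂))

  exchange-invariant : ∀ {c₁ v₁ c₂ v₂} → c₁ % 2 ≡ 1 → c₂ % 2 ≡ 1 → Coprime c₁ c₂ →
    Residue a r c₁ v₁ → Residue a r c₂ v₂ →
    Invariant (c₁ ℕ.+ c₂) (exchange ((+ c₁ , + v₁) , (+ c₂ , + v₂)))
  exchange-invariant {c₁} {v₁} {c₂} {v₂} odd₁ odd₂ coprime res₁ res₂
    -- The integer comparison in `exchange` computes to this Boolean.
    with c₂ ℕ.<ᵇ c₁ | ℕ.<ᵇ-reflects-< c₂ c₁
  ... | true  | ofʸ c₂<c₁ = subst (λ n → Invariant n ((+ c₂ , + v₂) , (+ c₁ , + v₁))) (ℕ.+-comm c₂ c₁)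
    (invariant (ℕ.<⇒≤ c₂<c₁) odd₂ odd₁ (Coprime.sym coprime) res₂ res₁)
  ... | false | ofⁿ c₂≮c₁ = invariant (ℕ.≮⇒≥ c₂≮c₁) odd₁ odd₂ coprime res₁ res₂

  -- The new entry `c′` divides the positive number `c₂ ∸ c₁`, so it is less than `c₂` and the sum
  -- drops. A common divisor of `c₁` and `c′` divides `c₂ ∸ c₁`, hence also `c₂`.
  iteration-invariant : ∀ {n c₁ v₁ p₂} → 1 ℕ.< c₁ → Invariant n ((+ c₁ , + v₁) , p₂) →
    ∃[ m ] ∃[ t ] m ℕ.< n × Iteration a ((+ c₁ , + v₁) , p₂) t × Invariant m t
  iteration-invariant {c₁ = c₁} 1<c₁
    (invariant {v₁ = v₁} {c₂ = c₂} {v₂ = v₂} c₁≤c₂ odd₁ odd₂ coprime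
      res₁@(residue v₁<a a∣₁) (residue v₂<a a∣₂))
    with subtract-residue v₁<a v₂<a
  ... | v , v<a , v-value , e , v-cong
    with div1-residue {c = c₂ ∸ c₁} {v = v} (ℕ.m<n⇒0<n∸m (coprime∧≤⇒< 1<c₁ c₁≤c₂ coprime))
           (residue v<a (subst (λ c → + a ∣ c - + v * + r) (+m-+n c₁≤c₂)
             (subtract-∣ (+ c₁) (+ c₂) (+ v₁) (+ v₂) (+ r) e v-cong a∣₁ a∣₂)))
  ... | c′ , v′ , steps , odd′ , c′∣ , res′ =
    c₁ ℕ.+ c′ , _ , ℕ.+-monoʳ-< c₁ c′<c₂ ,
    iteration (subst (λ (c , w) → Div1 a c w (+ c′ , + v′))
      (cong₂ _,_ (sym (+m-+n c₁≤c₂)) (sym v-value)) steps) ,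
    exchange-invariant odd₁ odd′ coprime′ res₁ res′
    where
    c₁<c₂ : c₁ ℕ.< c₂
    c₁<c₂ = coprime∧≤⇒< 1<c₁ c₁≤c₂ coprime
    c′<c₂ : c′ ℕ.< c₂
    c′<c₂ = ℕ.≤-<-trans (ℕ.∣⇒≤ {{ℕ.>-nonZero (ℕ.m<n⇒0<n∸m c₁<c₂)}} c′∣)
      (ℕ.∸-monoʳ-< (ℕ.<-trans z<s 1<c₁) c₁≤c₂)
    coprime′ : Coprime c₁ c′
    coprime′ (d∣c₁ , d∣c′) =
      coprime (d∣c₁ , ℕ.∣m∸n∣n⇒∣m _ c₁≤c₂ (ℕ.∣-trans d∣c′ c′∣) d∣c₁)

  -- Well-founded recursion on the sum. At exit `c₁` is odd and at most 1, so it equals 1.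
  loop-result : ∀ {n s} → Acc ℕ._<_ n → Invariant n s →
    ∃[ v ] ∃[ p ]
      While (λ ((c₁ , _) , _) → 1ℤ ℤ.< c₁) (Iteration a) s ((1ℤ , + v) , p) × Residue a r 1 v
  loop-result (acc rec) inv@(invariant {c₁ = c₁} {v₁} _ odd₁ _ _ res₁ _) with 1 ℕ.<? c₁
  ... | no 1≮c₁ with refl ← odd∧≯1⇒≡1 c₁ odd₁ 1≮c₁ = v₁ , _ , stop (λ { (+<+ (s≤s ())) }) , res₁
  ... | yes 1<c₁ with iteration-invariant 1<c₁ inv
  ... | m , t , m<n , step , inv′ with loop-result (rec m<n) inv′
  ...   | v , p , steps , res = v , p , next (+<+ 1<c₁) step steps , res

-- Initialization, output and uniqueness.

module _ (a b : ℕ) .{{_ : NonZero a}} where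

  private
    r = b % a
    q = b / a

  initial-residue₁ : 1 ℕ.< a → Residue a r r 1
  initial-residue₁ 1<a = residue 1<a (divides 0ℤ (rearrange (+ r)))
    where
    rearrange : ∀ r → r - 1ℤ * r ≡ 0ℤ
    rearrange = solve-∀

  -- Modulo `a`, both `a - r` and `(a - 1) * r` are `- r`; their difference is exactly
  -- `(1 - r) * a`.
  initial-residue₂ : 1 ℕ.< a → Residue a r (a ∸ r) (a ∸ 1)
  initial-residue₂ 1<a = residue (ℕ.∸-monoʳ-< z<s (ℕ.<⇒≤ 1<a)) (divides (1ℤ - + r) (begin
    + (a ∸ r) - + (a ∸ 1) * + r
      ≡⟨ cong₂ (λ x y → x - y * + r) (+m-+n (ℕ.m%n≤n b a)) (+m-+n (ℕ.<⇒≤ 1<a)) ⟨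
    + a - + r - (+ a - 1ℤ) * + r
      ≡⟨ rearrange (+ a) (+ r) ⟩
    (1ℤ - + r) * + a ∎))
    where
    open ≡-Reasoning
    rearrange : ∀ a r → a - r - (a - 1ℤ) * r ≡ (1ℤ - r) * a
    rearrange = solve-∀

  coprime-remainder : Coprime a b → Coprime a r
  coprime-remainder coprime (d∣a , d∣r) = coprime (d∣a , ℕ.∣n∣m%n⇒∣m d∣a d∣r)

  -- With first entry 1 the congruence says that `a` divides `1 - v * r`, so the quotient in
  -- `output` is exact. Substituting `b = r + q * a` then gives the equation.
  output-solution : ∀ v p → Residue a r 1 v → IsSolution a b (output a b ((1ℤ , + v) , p))
  output-solution v p (residue v<a a∣) = equation , +≤+ z≤n , +<+ v<a
    where
    open ≡-Reasoning
    k = (1ℤ - + v * + r) /ℕ a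
    rearrange₁ : ∀ v q k a r → (- v * q + k) * a + v * (r + q * a) ≡ k * a + v * r
    rearrange₁ = solve-∀
    rearrange₂ : ∀ x → 1ℤ - x + x ≡ 1ℤ
    rearrange₂ = solve-∀
    equation : (- + v * + q + k) * + a + + v * + b ≡ 1ℤ
    equation = begin
      (- + v * + q + k) * + a + + v * + b
        ≡⟨ cong (λ x → (- + v * + q + k) * + a + + v * x) (a≡a%ℕn+[a/ℕn]*n (+ b) a) ⟩
      (- + v * + q + k) * + a + + v * (+ r + + q * + a)
        ≡⟨ rearrange₁ (+ v) (+ q) k (+ a) (+ r) ⟩
      k * + a + + v * + r
        ≡⟨ cong (_+ + v * + r) (%ℕ≡0⇒≡/ℕ* (1ℤ - + v * + r) a (∣⇒%ℕ≡0 a∣)) ⟨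
      1ℤ - + v * + r + + v * + r
        ≡⟨ rearrange₂ (+ v * + r) ⟩
      1ℤ ∎

  wwl1-correct : Coprime a b → a % 2 ≡ 1 → 1 ℕ.< a →
    Σ[ out ∈ ℤ × ℤ ] WWL1 a b out × IsSolution a b out
  wwl1-correct coprime a-odd 1<a
    with div1-residue a-odd 0<r (initial-residue₁ 1<a)
       | div1-residue a-odd (ℕ.m<n⇒0<n∸m (ℕ.m%n<n b a)) (initial-residue₂ 1<a)
    where
    -- If `r` were 0, then `a > 1` would be a common divisor of `a` and `r`.
    0<r : 0 ℕ.< r
    0<r = ℕ.n≢0⇒n>0 λ r≡0 → ℕ.<⇒≢ 1<a
      (sym (coprime-remainder coprime (ℕ.∣-refl , subst (a ℕ.∣_) (sym r≡0) (a ℕ.∣0))))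
  ... | c₁ , v₁ , steps₁ , odd₁ , c₁∣ , res₁ | c₂ , v₂ , steps₂ , odd₂ , c₂∣ , res₂
    with loop-result a-odd (<-wellFounded _) (exchange-invariant a-odd odd₁ odd₂ coprime₁₂ res₁ res₂)
    where
    -- A common divisor of `c₁` and `c₂` divides `r` and `a ∸ r`, hence also `a`.
    coprime₁₂ : Coprime c₁ c₂
    coprime₁₂ (d∣c₁ , d∣c₂) = coprime-remainder coprime
      (ℕ.∣m∸n∣n⇒∣m _ (ℕ.m%n≤n b a) (ℕ.∣-trans d∣c₂ c₂∣) d∣r , d∣r)
      where d∣r = ℕ.∣-trans d∣c₁ c₁∣
  ... | v , p , steps , res = output a b ((1ℤ , + v) , p) ,
    run steps₁
      (subst (λ (c , w) → Div1 a c w (+ c₂ , + v₂))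
        (cong₂ _,_ (sym (+m-+n (ℕ.m%n≤n b a))) (sym (+m-+n (ℕ.<⇒≤ 1<a)))) steps₂)
      steps ,
    output-solution v p res

  -- Multiplying each equation by the other solution's `v` and subtracting eliminates `b`, so `a`
  -- divides `v - v′`. The range of the two values forces `v = v′`, and cancelling `a` gives
  -- `u = u′`.
  solution-unique : ∀ {s t} → IsSolution a b s → IsSolution a b t → s ≡ t
  solution-unique {u , v} {u′ , v′} (eq , +≤+ _ , +<+ v<a) (eq′ , +≤+ _ , +<+ v′<a)
    with ∣-⇒≡ v<a v′<a (divides (v * u′ - v′ * u) v-v′)
    where
    open ≡-Reasoning
    rearrange : ∀ a b u v u′ v′ →
      v * (u′ * a + v′ * b) - v′ * (u * a + v * b) ≡ (v * u′ - v′ * u) * a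
    rearrange = solve-∀
    v-v′ : v - v′ ≡ (v * u′ - v′ * u) * + a
    v-v′ = begin
      v - v′
        ≡⟨ cong₂ _-_ (ℤ.*-identityʳ v) (ℤ.*-identityʳ v′) ⟨
      v * 1ℤ - v′ * 1ℤ
        ≡⟨ cong₂ (λ x y → v * x - v′ * y) eq′ eq ⟨
      v * (u′ * + a + v′ * + b) - v′ * (u * + a + v * + b)
        ≡⟨ rearrange (+ a) (+ b) u v u′ v′ ⟩
      (v * u′ - v′ * u) * + a ∎
  ... | refl = cong (_, v) (ℤ.*-cancelʳ-≡ u u′ (+ a) (∙-cancelʳ (v * + b) _ _ (trans eq (sym eq′))))

mainTheorem1 : (a b : ℕ) .{{_ : NonZero a}} .{{_ : NonZero b}} →
    gcd a b ≡ 1 → a % 2 ≡ 1 → a ≢ 1 →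
    Σ[ out ∈ ℤ × ℤ ]
      WWL1 a b out × IsSolution a b out × (∀ out′ → IsSolution a b out′ → out′ ≡ out)
mainTheorem1 a b gcd≡1 a-odd a≢1 =
  let out , terminates , solution = wwl1-correct a b (gcd≡1⇒coprime gcd≡1) a-odd
        (ℕ.≤∧≢⇒< (ℕ.>-nonZero⁻¹ a) (a≢1 ∘ sym))
  in out , terminates , solution , λ _ solution′ → solution-unique a b solution′ solution
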